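{- Let $C$ be a cycle (oriented or not) and let $Ck$ be a diagram obtained by adjoining to $C$ a new vertex $k$ adjacent to some vertices of $C$ (so $C$ is the subdiagram of $Ck$ on the vertices other than $k$). Let $A$ be a quasi-Cartan companion of $Ck$ such that $\prod_{\{i,j\}\in C}(-A_{i,j})$ over the edges of $C$ is negative. Suppose that $k$ is adjacent to an even number of vertices of $C$, and that among them there are two vertices which are not adjacent to each other in $C$. Then $Ck$ has a cycle $C'$ containing $k$ such that $\prod_{\{i,j\}\in C'}(-A_{i,j})$ is positive.
   Context: Skew-symmetrizable: integer square $B$ with $DB$ skew-symmetric for a diagonal $D$ with positive diagonal. The diagram $\Gamma(B)$: vertices $1,\dots,n$, edge $i\to j$ iff $B_{i,j}>0$, weight $|B_{i,j}B_{j,i}|$; a diagram is any such $\Gamma(B)$. A cycle is an induced subdiagram on $r\ge3$ vertices whose underlying graph is an $r$-cycle; oriented if cyclically oriented. Quasi-Cartan matrix: integer $A$ with diagonal entries 2 and $DA$ symmetric for some positive diagonal $D$. A quasi-Cartan companion of a diagram $\Gamma$ is a quasi-Cartan $A$ with $|A_{i,j}|=|B_{i,j}|$ ($i\ne j$) for some skew-symmetrizable $B$ with $\Gamma(B)=\Gamma$. -}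

module Defs where

open import Data.Nat using (ℕ; zero; suc; _+_)
open import Data.Nat.Divisibility using (_∣_)
open import Data.Integer using (ℤ; +_; -_; _*_; ∣_∣; _<_; 0ℤ; 1ℤ)
open import Data.Fin using (Fin; zero; suc)
open import Data.List using (List; length; filter; allFin)
open import Data.Product using (Σ; ∃; _×_; _,_)
open import Data.Sum using (_⊎_)
open import Relation.Nullary using (¬_; Dec; yes; no; ¬?)
open import Relation.Binary.PropositionalEquality using (_≡_; _≢_)
open import Function.Bundles using (_⇔_)
open import Function.Definitions using (Injective)
import Data.Integer.Properties as ℤP

-- square integer matrices indexed by Fin n
Mat : ℕ → Set
Mat n = Fin n → Fin n → ℤ

-- B is skew-symmetrizable: D B skew-symmetric for a diagonal D with positive entries,
-- i.e. d_i B_ij = - d_j B_ji for all i, j.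
SkewSymmetrizable : ∀ {n} → Mat n → Set
SkewSymmetrizable {n} B =
  Σ (Fin n → ℤ) λ d → (∀ i → 0ℤ < d i) × (∀ i j → d i * B i j ≡ - (d j * B j i))

-- A diagram on n vertices is encoded by its signed weights:
-- entry (i,j) is  + w  if there is an edge i → j of weight w,
--                 - w  if there is an edge j → i of weight w,
--                 0    if i and j are not joined.
Diagram : ℕ → Set
Diagram n = Mat n

-- The diagram Γ(B): edge i → j iff B_ij > 0, of weight |B_ij B_ji|.
-- Encoded as B_ij * |B_ji| = sign(B_ij) * |B_ij B_ji|.
Γ : ∀ {n} → Mat n → Diagram n
Γ B i j = B i j * (+ ∣ B j i ∣)

-- i and j are adjacent in the diagram
Adj : ∀ {n} → Diagram n → Fin n → Fin n → Set
Adj G i j = ¬ (G i j ≡ 0ℤ)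

Adj? : ∀ {n} (G : Diagram n) i j → Dec (Adj G i j)
Adj? G i j = ¬? (G i j ℤP.≟ 0ℤ)

-- Quasi-Cartan matrix: diagonal entries 2, D A symmetric for a positive diagonal D.
QuasiCartan : ∀ {n} → Mat n → Set
QuasiCartan {n} A =
  (∀ i → A i i ≡ + 2) ×
  Σ (Fin n → ℤ) λ d → (∀ i → 0ℤ < d i) × (∀ i j → d i * A i j ≡ d j * A j i)

-- A is a quasi-Cartan companion of the diagram G.
QuasiCartanCompanion : ∀ {n} → Diagram n → Mat n → Set
QuasiCartanCompanion {n} G A =
  QuasiCartan A ×
  Σ (Mat n) λ B → SkewSymmetrizable B × (∀ i j → Γ B i j ≡ G i j) ×
                  (∀ i j → i ≢ j → ∣ A i j ∣ ≡ ∣ B i j ∣)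

-- cyclic successor on Fin (suc n): a ↦ a + 1 mod (suc n)
next : ∀ {n} → Fin (suc n) → Fin (suc n)
next {zero} zero = zero
next {suc n} zero = suc zero
next {suc n} (suc a) with next {n} a
... | zero = zero
... | suc b = suc (suc b)

-- product of an integer family indexed by Fin r
prodFin : ∀ r → (Fin r → ℤ) → ℤ
prodFin zero f = 1ℤ
prodFin (suc r) f = f zero * prodFin r (λ a → f (suc a))

-- v : Fin (3 + s) → Fin n lists (in cyclic order) the vertices of a cycle of G
-- on 3 + s ≥ 3 vertices: distinct vertices, and the induced underlying graph is
-- exactly the cycle v_0 - v_1 - ... - v_{r-1} - v_0.
IsCycle : ∀ {n} → Diagram n → (s : ℕ) → (Fin (3 + s) → Fin n) → Set
IsCycle G s v =
  Injective _≡_ _≡_ v ×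
  (∀ a b → a ≢ b → (Adj G (v a) (v b) ⇔ (b ≡ next a ⊎ a ≡ next b)))

-- ∏_{edges {i,j} of the cycle} (- A_ij)
cycleProd : ∀ {n} → Mat n → (s : ℕ) → (Fin (3 + s) → Fin n) → ℤ
cycleProd A s v = prodFin (3 + s) (λ a → - A (v a) (v (next a)))

-- number of cycle positions a such that k is adjacent to v_a
adjCount : ∀ {n r} → Diagram n → Fin n → (Fin r → Fin n) → ℕ
adjCount {r = r} G k v = length (filter (λ a → Adj? G k (v a)) (allFin r))

-- Unroll C along ℕ, position i standing for its vertex number i mod r, and mark the positions
-- whose vertex is adjacent to k.  Write t i for the sign of -A on the edge (i, i+1) of C and
-- e i for the sign of -A on the edge (k, i); symmetrizability of A makes the two entries of an
-- edge agree in sign.  Two consecutive marks p < q cut out an arc which, together with k, spans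
-- a cycle of sign e p · t p ⋯ t (q - 1) · e q.  Multiplying these arc signs once around C, each
-- e i occurs twice, so the product is the sign of C, namely -1; if every arc were negative it
-- would be (-1)^(number of marks) = +1.  So some arc is positive, and the two non-adjacent
-- neighbours of k make every arc miss at least two vertices of C, so that arc and k span an
-- induced cycle.
module Submission where

open import Data.Bool using (Bool; true; false)
open import Data.Fin using (Fin; zero; suc; toℕ)
open import Data.Fin.Properties using (toℕ<n; toℕ-injective; toℕ-fromℕ<)
open import Data.Integer as ℤ using (ℤ; +_; +[1+_]; -[1+_]; -_; 0ℤ; _<_; sign; ∣_∣)
import Data.Integer.Properties as ℤ
open import Data.List using (length; filter; tabulate)
open import Data.Nat as ℕ using (ℕ; zero; suc; _+_; _∸_; _≤_; z≤n; s≤s)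
open import Data.Nat.DivMod
  using (_%_; _/_; _mod_; m≡m%n+[m/n]*n; n%n≡0; m<n⇒m%n≡m; %-distribˡ-+; m%n%n≡m%n; [m+n]%n≡m%n)
open import Data.Nat.Divisibility using (_∣_; divides-refl)
import Data.Nat.Properties as ℕ
open import Data.Product using (Σ; ∃; ∃₂; _×_; _,_; proj₁; proj₂)
open import Data.Sign as Sign using (Sign; _*_)
import Data.Sign.Properties as Sign
open import Data.Sum using (_⊎_; inj₁; inj₂; [_,_]′)
open import Data.Sum.Algebra using (⊎-comm)
open import Data.Sum.Function.Propositional using (_⊎-⇔_)
open import Function using (_∘_; id)
open import Function.Bundles using (_⇔_; mk⇔; Equivalence)
open import Function.Definitions using (Injective)
import Function.Properties.Equivalence as ⇔
open import Function.Properties.Inverse using (↔⇒⇔)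
open import Relation.Binary.Definitions using (Symmetric)
open import Relation.Binary.PropositionalEquality
open import Relation.Nullary using (¬_; does; yes; no)
open import Relation.Nullary.Decidable using (dec-true; dec-false)
open import Relation.Nullary.Negation using (contradiction)
open import Relation.Unary as U using (Pred)

open import Algebra.Properties.Monoid.Sum Sign.*-monoid using () renaming (sum to ∏ˢ; sum-cong-≗ to ∏ˢ-cong)
open import Algebra.Properties.Monoid.Mult Sign.*-monoid using () renaming (_×_ to _×ˢ_)

open import Defs

sign-pos-* : ∀ {d} a → 0ℤ < d → sign (d ℤ.* a) ≡ sign a
sign-pos-* {+ zero} _ (ℤ.+<+ ())
sign-pos-* {+[1+ m ]} (+ zero) _ = cong sign (ℤ.*-zeroʳ +[1+ m ])
sign-pos-* {+[1+ m ]} +[1+ n ] _ = refl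
sign-pos-* {+[1+ m ]} -[1+ n ] _ = refl

sign≡+⇒0< : ∀ {x} → x ≢ 0ℤ → sign x ≡ Sign.+ → 0ℤ < x
sign≡+⇒0< {+ zero} x≢0 _ = contradiction refl x≢0
sign≡+⇒0< {+[1+ n ]} _ _ = ℤ.+<+ (s≤s z≤n)

<0⇒sign≡- : ∀ {x} → x < 0ℤ → sign x ≡ Sign.-
<0⇒sign≡- { -[1+ n ]} _ = refl
<0⇒sign≡- {+ n} (ℤ.+<+ ())

prodFin-cong : ∀ m {f g : Fin m → ℤ} → (∀ a → f a ≡ g a) → prodFin m f ≡ prodFin m g
prodFin-cong zero f≗g = refl
prodFin-cong (suc m) f≗g = cong₂ ℤ._*_ (f≗g zero) (prodFin-cong m (f≗g ∘ suc))

sign-prodFin : ∀ m (f : Fin m → ℤ) → (∀ a → f a ≢ 0ℤ) →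
               prodFin m f ≢ 0ℤ × sign (prodFin m f) ≡ ∏ˢ (sign ∘ f)
sign-prodFin zero f f≢0 = (λ ()) , refl
sign-prodFin (suc m) f f≢0 with sign-prodFin m (f ∘ suc) (f≢0 ∘ suc)
... | ∏≢0 , sign∏ = f∏≢0 , trans (ℤ.sign-* (f zero) _ {{ℤ.≢-nonZero f∏≢0}}) (cong (sign (f zero) *_) sign∏)
  where
  f∏≢0 : f zero ℤ.* prodFin m (f ∘ suc) ≢ 0ℤ
  f∏≢0 eq = [ f≢0 zero , ∏≢0 ]′ (ℤ.i*j≡0⇒i≡0∨j≡0 _ eq)

≢+⇒≡- : ∀ {s} → s ≢ Sign.+ → s ≡ Sign.-
≢+⇒≡- {Sign.-} _ = refl
≢+⇒≡- {Sign.+} s≢+ = contradiction refl s≢+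

*≡-⇒≡-* : ∀ s t → s * t ≡ Sign.- → s ≡ Sign.- * t
*≡-⇒≡-* s t st≡- = Sign.*-cancelʳ-≡ t s (Sign.- * t) (trans st≡- (sym (Sign.opposite[s]*s≡- t)))

markSign : Bool → Sign
markSign true = Sign.-
markSign false = Sign.+

×ˢ-length-filter : ∀ {a p} {A : Set a} {P : Pred A p} (P? : U.Decidable P) m (g : Fin m → A) →
  length (filter P? (tabulate g)) ×ˢ Sign.- ≡ ∏ˢ (λ a → markSign (does (P? (g a))))
×ˢ-length-filter P? zero g = refl
×ˢ-length-filter P? (suc m) g with does (P? (g zero))
... | true = cong (Sign.- *_) (×ˢ-length-filter P? m (g ∘ suc))
... | false = ×ˢ-length-filter P? m (g ∘ suc)

even-×ˢ- : ∀ {c} → 2 ∣ c → c ×ˢ Sign.- ≡ Sign.+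
even-×ˢ- (divides-refl q) = go q
  where
  go : ∀ q → (q ℕ.* 2) ×ˢ Sign.- ≡ Sign.+
  go zero = refl
  go (suc q) = trans (Sign.opposite-involutive _) (go q)

∏ᵂ : (ℕ → Sign) → ℕ → ℕ → Sign
∏ᵂ g j zero = Sign.+
∏ᵂ g j (suc m) = ∏ᵂ g j m * g (j + m)

∏ᵂ-shift : ∀ {g h j k} m → (∀ i → i ℕ.< m → g (j + i) ≡ h (k + i)) → ∏ᵂ g j m ≡ ∏ᵂ h k m
∏ᵂ-shift zero eq = refl
∏ᵂ-shift (suc m) eq = cong₂ _*_ (∏ᵂ-shift m (λ i i<m → eq i (ℕ.m<n⇒m<1+n i<m))) (eq m ℕ.≤-refl)

∏ᵂ-cons : ∀ g j m → ∏ᵂ g j (suc m) ≡ g j * ∏ᵂ g (suc j) m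
∏ᵂ-cons g j zero = trans (cong g (ℕ.+-identityʳ j)) (sym (Sign.*-identityʳ (g j)))
∏ᵂ-cons g j (suc m) = begin
  ∏ᵂ g j (suc m) * g (j + suc m)        ≡⟨ cong₂ _*_ (∏ᵂ-cons g j m) (cong g (ℕ.+-suc j m)) ⟩
  g j * ∏ᵂ g (suc j) m * g (suc j + m)  ≡⟨ Sign.*-assoc (g j) _ _ ⟩
  g j * ∏ᵂ g (suc j) (suc m)            ∎
  where open ≡-Reasoning

∏ᵂ-periodic : ∀ {g r} → (∀ i → g (i + r) ≡ g i) → ∀ j → ∏ᵂ g j r ≡ ∏ᵂ g 0 r
∏ᵂ-periodic per zero = refl
∏ᵂ-periodic {g} {r} per (suc j) = trans (Sign.*-cancelˡ-≡ (g j) _ _ shift) (∏ᵂ-periodic per j)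
  where
  open ≡-Reasoning
  shift : g j * ∏ᵂ g (suc j) r ≡ g j * ∏ᵂ g j r
  shift = begin
    g j * ∏ᵂ g (suc j) r  ≡⟨ ∏ᵂ-cons g j r ⟨
    ∏ᵂ g j r * g (j + r)  ≡⟨ cong (∏ᵂ g j r *_) (per j) ⟩
    ∏ᵂ g j r * g j        ≡⟨ Sign.*-comm (∏ᵂ g j r) (g j) ⟩
    g j * ∏ᵂ g j r        ∎

∏ˢ-∏ᵂ : ∀ g j m → ∏ˢ {m} (λ a → g (j + toℕ a)) ≡ ∏ᵂ g j m
∏ˢ-∏ᵂ g j zero = refl
∏ˢ-∏ᵂ g j (suc m) = begin
  g (j + 0) * ∏ˢ {m} (λ a → g (j + suc (toℕ a)))  ≡⟨ cong₂ _*_ (cong g (ℕ.+-identityʳ j))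
                                                       (∏ˢ-cong {m} (λ a → cong g (ℕ.+-suc j (toℕ a)))) ⟩
  g j * ∏ˢ {m} (λ a → g (suc j + toℕ a))          ≡⟨ cong (g j *_) (∏ˢ-∏ᵂ g (suc j) m) ⟩
  g j * ∏ᵂ g (suc j) m                            ≡⟨ ∏ᵂ-cons g j m ⟨
  ∏ᵂ g j (suc m)                                  ∎
  where open ≡-Reasoning

module ArcDecomposition (t e : ℕ → Sign) {ℓ} {N : Pred ℕ ℓ} (N? : U.Decidable N) where

  χ : ℕ → Sign
  χ i = markSign (does (N? i))

  χ-marked : ∀ {i} → N i → χ i ≡ Sign.-
  χ-marked {i} N-i = cong markSign (dec-true (N? i) N-i)

  χ-unmarked : ∀ {i} → ¬ N i → χ i ≡ Sign.+
  χ-unmarked {i} ¬N-i = cong markSign (dec-false (N? i) ¬N-i)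

  arcSign : ℕ → ℕ → Sign
  arcSign p d = e p * ∏ᵂ t p d * e (p + d)

  Unmarked : ℕ → ℕ → Set ℓ
  Unmarked p d = ∀ i → 0 ℕ.< i → i ℕ.< d → ¬ N (p + i)

  Consecutive : ℕ → ℕ → Set ℓ
  Consecutive p d = N p × N (p + d) × Unmarked p d

  PositiveArcIn : ℕ → ℕ → Set ℓ
  PositiveArcIn B m = ∃₂ λ p d → B ≤ p × p + suc d ≤ B + m ×
    Consecutive p (suc d) × arcSign p (suc d) ≡ Sign.+

  -- The state after scanning B, …, B + m from the mark B: every arc closed so far is negative,
  -- so their product is ∏ᵂ χ (suc B) m, and the arc opened at the last mark B + last is pending.
  record Walk (B m : ℕ) : Set ℓ where
    field
      last gap : ℕ
      last+gap : last + gap ≡ m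
      marked   : N (B + last)
      unmarked : Unmarked (B + last) (suc gap)
      signs    : e B * ∏ᵂ t B m ≡ ∏ᵂ χ (suc B) m * (e (B + last) * ∏ᵂ t (B + last) gap)

  module _ {B m} (w : Walk B m) where
    open Walk w
    open ≡-Reasoning

    private
      P : Sign
      P = ∏ᵂ χ (suc B) m
      pending : Sign
      pending = e (B + last) * ∏ᵂ t (B + last) (suc gap)

    walk-current : B + last + gap ≡ B + m
    walk-current = trans (ℕ.+-assoc B last gap) (cong (λ j → B + j) last+gap)

    walk-next : B + last + suc gap ≡ B + suc m
    walk-next = trans (ℕ.+-suc (B + last) gap) (trans (cong suc walk-current) (sym (ℕ.+-suc B m)))

    walk-step : e B * ∏ᵂ t B (suc m) ≡ P * pending
    walk-step = begin
      e B * (∏ᵂ t B m * t (B + m))          ≡⟨ Sign.*-assoc (e B) _ _ ⟨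
      e B * ∏ᵂ t B m * t (B + m)            ≡⟨ cong (_* t (B + m)) signs ⟩
      P * (e p * ∏ᵂ t p gap) * t (B + m)    ≡⟨ Sign.*-assoc P _ _ ⟩
      P * (e p * ∏ᵂ t p gap * t (B + m))    ≡⟨ cong (P *_) (Sign.*-assoc (e p) _ _) ⟩
      P * (e p * (∏ᵂ t p gap * t (B + m)))  ≡⟨ cong (λ i → P * (e p * (∏ᵂ t p gap * t i))) walk-current ⟨
      P * pending                           ∎
      where
      p : ℕ
      p = B + last

    walk-skip : ¬ N (B + suc m) → Walk B (suc m)
    walk-skip ¬N-next = record
      { last = last ; gap = suc gap
      ; last+gap = trans (ℕ.+-suc last gap) (cong suc last+gap)
      ; marked = marked
      ; unmarked = unmarked′
      ; signs = begin
          e B * ∏ᵂ t B (suc m)            ≡⟨ walk-step ⟩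
          P * pending                     ≡⟨ cong (_* pending) (Sign.*-identityʳ P) ⟨
          P * Sign.+ * pending            ≡⟨ cong (λ s → P * s * pending)
                                               (χ-unmarked (subst (¬_ ∘ N) (ℕ.+-suc B m) ¬N-next)) ⟨
          ∏ᵂ χ (suc B) (suc m) * pending  ∎
      }
      where
      unmarked′ : Unmarked (B + last) (suc (suc gap))
      unmarked′ i 0<i i<2+gap with i ℕ.≟ suc gap
      ... | yes refl   = subst (¬_ ∘ N) (sym walk-next) ¬N-next
      ... | no i≢1+gap = unmarked i 0<i (ℕ.≤∧≢⇒< (ℕ.≤-pred i<2+gap) i≢1+gap)

    walk-arc : N (B + suc m) → Consecutive (B + last) (suc gap)
    walk-arc N-next = marked , subst N (sym walk-next) N-next , unmarked

    walk-close : N (B + suc m) → arcSign (B + last) (suc gap) ≢ Sign.+ → Walk B (suc m)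
    walk-close N-next negative = record
      { last = suc m ; gap = 0 ; last+gap = ℕ.+-identityʳ (suc m)
      ; marked = N-next
      ; unmarked = λ { (suc i) _ (s≤s ()) }
      ; signs = begin
          e B * ∏ᵂ t B (suc m)                            ≡⟨ walk-step ⟩
          P * pending                                     ≡⟨ cong (P *_) (*≡-⇒≡-* pending _ (≢+⇒≡- negative)) ⟩
          P * (Sign.- * e (B + last + suc gap))            ≡⟨ Sign.*-assoc P Sign.- _ ⟨
          P * Sign.- * e (B + last + suc gap)              ≡⟨ cong₂ (λ s i → P * s * e i)
                                                               (sym (χ-marked (subst N (ℕ.+-suc B m) N-next)))
                                                               walk-next ⟩
          ∏ᵂ χ (suc B) (suc m) * e (B + suc m)             ≡⟨ cong (∏ᵂ χ (suc B) (suc m) *_) (Sign.*-identityʳ _) ⟨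
          ∏ᵂ χ (suc B) (suc m) * (e (B + suc m) * Sign.+)  ∎
      }

  walk : ∀ {B} m → N B → PositiveArcIn B m ⊎ Walk B m
  walk {B} zero N-B = inj₂ record
    { last = 0 ; gap = 0 ; last+gap = refl
    ; marked = subst N (sym (ℕ.+-identityʳ B)) N-B
    ; unmarked = λ { (suc i) _ (s≤s ()) }
    ; signs = cong (λ j → e j * Sign.+) (sym (ℕ.+-identityʳ B))
    }
  walk {B} (suc m) N-B with walk m N-B
  ... | inj₁ (p , d , B≤p , arc≤ , arc) =
    inj₁ (p , d , B≤p , ℕ.≤-trans arc≤ (ℕ.+-monoʳ-≤ B (ℕ.n≤1+n m)) , arc)
  ... | inj₂ w with N? (B + suc m)
  ...   | no ¬N-next = inj₂ (walk-skip w ¬N-next)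
  ...   | yes N-next with arcSign (B + Walk.last w) (suc (Walk.gap w)) Sign.≟ Sign.+
  ...     | yes positive = inj₁ (B + Walk.last w , Walk.gap w , ℕ.m≤m+n B (Walk.last w) ,
                                 ℕ.≤-reflexive (walk-next w) , walk-arc w N-next , positive)
  ...     | no negative  = inj₂ (walk-close w N-next negative)

  closed-walk : ∀ {B m} → N B → N (B + m) →
                PositiveArcIn B m ⊎ e B * ∏ᵂ t B m ≡ ∏ᵂ χ (suc B) m * e (B + m)
  closed-walk {B} {m} N-B N-end with walk m N-B
  ... | inj₁ arc = inj₁ arc
  ... | inj₂ w   = inj₂ (trans signs (cong (∏ᵂ χ (suc B) m *_) closing))
    where
    open Walk w
    open ≡-Reasoning
    gap≡0 : gap ≡ 0
    gap≡0 with gap | unmarked | walk-current w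
    ... | zero  | _         | _       = refl
    ... | suc g | unmarked′ | current =
      contradiction (subst N (sym current) N-end) (unmarked′ (suc g) (s≤s z≤n) ℕ.≤-refl)
    closing : e (B + last) * ∏ᵂ t (B + last) gap ≡ e (B + m)
    closing = begin
      e (B + last) * ∏ᵂ t (B + last) gap  ≡⟨ cong (λ g → e (B + last) * ∏ᵂ t (B + last) g) gap≡0 ⟩
      e (B + last) * Sign.+               ≡⟨ Sign.*-identityʳ _ ⟩
      e (B + last)                        ≡⟨ cong e (trans (sym (ℕ.+-identityʳ _))
                                               (subst (λ g → B + last + g ≡ B + m) gap≡0 (walk-current w))) ⟩
      e (B + m)                           ∎

  marks-in-arc : ∀ {p d} → Consecutive p d → ∀ i → i ≤ d → N (p + i) ⇔ (i ≡ 0 ⊎ i ≡ d)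
  marks-in-arc {p} {d} (N-p , N-end , unmarked) i i≤d = mk⇔ endpoint λ
    { (inj₁ refl) → subst N (sym (ℕ.+-identityʳ p)) N-p
    ; (inj₂ refl) → N-end
    }
    where
    endpoint : N (p + i) → i ≡ 0 ⊎ i ≡ d
    endpoint N-i with i ℕ.≟ 0 | i ℕ.≟ d
    ... | yes i≡0 | _       = inj₁ i≡0
    ... | no _    | yes i≡d = inj₂ i≡d
    ... | no i≢0  | no i≢d  = contradiction N-i (unmarked i (ℕ.n≢0⇒n>0 i≢0) (ℕ.≤∧≢⇒< i≤d i≢d))

  marks-outside : ∀ {p d I} → Unmarked p d → N I → I ≤ p ⊎ p + d ≤ I
  marks-outside {p} {d} {I} unmarked N-I with p ℕ.<? I | I ℕ.<? p + d
  ... | no p≮I  | _         = inj₁ (ℕ.≮⇒≥ p≮I)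
  ... | yes _   | no I≮p+d  = inj₂ (ℕ.≮⇒≥ I≮p+d)
  ... | yes p<I | yes I<p+d = contradiction (subst N (sym p+[I∸p]≡I) N-I)
    (unmarked (I ∸ p) (ℕ.m<n⇒0<n∸m p<I) (ℕ.+-cancelˡ-< p _ _ (subst (ℕ._< p + d) (sym p+[I∸p]≡I) I<p+d)))
    where
    p+[I∸p]≡I : p + (I ∸ p) ≡ I
    p+[I∸p]≡I = ℕ.m+[n∸m]≡n (ℕ.<⇒≤ p<I)

/-≤-window : ∀ {x y} n .{{_ : ℕ.NonZero n}} → x % n ≡ y % n → x ℕ.< y + n → x / n ≤ y / n
/-≤-window {x} {y} n x%n≡y%n x<y+n = ℕ.≤-pred (ℕ.*-cancelʳ-< n (x / n) (suc (y / n))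
  (ℕ.+-cancelˡ-< (x % n) _ _ (begin-strict
    x % n + x / n ℕ.* n        ≡⟨ m≡m%n+[m/n]*n x n ⟨
    x                          <⟨ x<y+n ⟩
    y + n                      ≡⟨ cong (_+ n) (m≡m%n+[m/n]*n y n) ⟩
    y % n + y / n ℕ.* n + n    ≡⟨ ℕ.+-assoc (y % n) _ n ⟩
    y % n + (y / n ℕ.* n + n)  ≡⟨ cong₂ _+_ (sym x%n≡y%n) (ℕ.+-comm _ n) ⟩
    x % n + suc (y / n) ℕ.* n  ∎)))
  where open ℕ.≤-Reasoning

%-injective-window : ∀ {x y} n .{{_ : ℕ.NonZero n}} → x % n ≡ y % n → x ℕ.< y + n → y ℕ.< x + n → x ≡ y
%-injective-window {x} {y} n x%n≡y%n x<y+n y<x+n = begin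
  x                    ≡⟨ m≡m%n+[m/n]*n x n ⟩
  x % n + x / n ℕ.* n  ≡⟨ cong₂ (λ a b → a + b ℕ.* n) x%n≡y%n
                            (ℕ.≤-antisym (/-≤-window n x%n≡y%n x<y+n) (/-≤-window n (sym x%n≡y%n) y<x+n)) ⟩
  y % n + y / n ℕ.* n  ≡⟨ m≡m%n+[m/n]*n y n ⟨
  y                    ∎
  where open ≡-Reasoning

short-arc : ∀ {B p d I r} → B ≤ p → p + d ≤ B + r → 2 + B ≤ I → 2 + I ≤ B + r →
            I ≤ p ⊎ p + d ≤ I → 2 + d ≤ r
short-arc {B} {p} {d} {I} {r} B≤p arc≤ 2+B≤I 2+I≤B+r (inj₁ I≤p) = ℕ.+-cancelˡ-≤ B _ _ (begin
  B + (2 + d)  ≡⟨ trans (sym (ℕ.+-assoc B 2 d)) (cong (_+ d) (ℕ.+-comm B 2)) ⟩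
  2 + B + d    ≤⟨ ℕ.+-monoˡ-≤ d (ℕ.≤-trans 2+B≤I I≤p) ⟩
  p + d        ≤⟨ arc≤ ⟩
  B + r        ∎)
  where open ℕ.≤-Reasoning
short-arc {B} {p} {d} {I} {r} B≤p arc≤ 2+B≤I 2+I≤B+r (inj₂ p+d≤I) = ℕ.+-cancelˡ-≤ B _ _ (begin
  B + (2 + d)  ≤⟨ ℕ.+-monoˡ-≤ (2 + d) B≤p ⟩
  p + (2 + d)  ≡⟨ trans (ℕ.+-suc p (suc d)) (cong suc (ℕ.+-suc p d)) ⟩
  2 + (p + d)  ≤⟨ ℕ.+-monoʳ-≤ 2 p+d≤I ⟩
  2 + I        ≤⟨ 2+I≤B+r ⟩
  B + r        ∎)
  where open ℕ.≤-Reasoning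

next-spec : ∀ {m} (a : Fin (suc m)) → (toℕ a ≡ m × next a ≡ zero) ⊎ toℕ (next a) ≡ suc (toℕ a)
next-spec {zero} zero = inj₁ (refl , refl)
next-spec {suc m} zero = inj₂ refl
next-spec {suc m} (suc a) with next a | next-spec a
... | zero  | inj₁ (a≡m , _) = inj₁ (cong suc a≡m , refl)
... | suc b | inj₂ b≡1+a     = inj₂ (cong suc b≡1+a)

next≢id : ∀ {m} (a : Fin (suc (suc m))) → next a ≢ a
next≢id a next≡a with next-spec a
... | inj₁ (a≡1+m , next≡0) = ℕ.0≢1+n (trans (cong toℕ (trans (sym next≡0) next≡a)) a≡1+m)
... | inj₂ next≡1+a = ℕ.1+n≢n (trans (sym next≡1+a) (cong toℕ next≡a))

toℕ-next : ∀ {m} (a : Fin (suc m)) → toℕ (next a) ≡ suc (toℕ a) % suc m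
toℕ-next {m} a with next-spec a
... | inj₁ (a≡m , next≡0) =
  trans (cong toℕ next≡0) (trans (sym (n%n≡0 (suc m))) (cong (λ i → suc i % suc m) (sym a≡m)))
... | inj₂ next≡1+a       = trans next≡1+a (sym (m<n⇒m%n≡m (subst (ℕ._< suc m) next≡1+a (toℕ<n (next a)))))

suc≡next-suc⇔ : ∀ {m} (i j : Fin (suc m)) → (suc j ≡ next (suc i)) ⇔ (toℕ j ≡ suc (toℕ i))
suc≡next-suc⇔ {m} i j with next (suc i) | next-spec (suc i)
... | zero  | inj₁ (1+i≡1+m , _) = mk⇔ (λ ()) λ j≡1+i →
  contradiction (subst (ℕ._< suc m) (trans j≡1+i 1+i≡1+m) (toℕ<n j)) (ℕ.n≮n (suc m))
... | suc k | inj₂ k≡1+i = mk⇔ (λ { refl → ℕ.suc-injective k≡1+i })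
                              (λ j≡1+i → cong suc (toℕ-injective (trans j≡1+i (sym (ℕ.suc-injective k≡1+i)))))

zero≡next-suc⇔ : ∀ {m} (j : Fin (suc m)) → (zero ≡ next (suc j)) ⇔ (toℕ j ≡ m)
zero≡next-suc⇔ {m} j with next (suc j) | next-spec (suc j)
... | zero  | inj₁ (1+j≡1+m , _) = mk⇔ (λ _ → ℕ.suc-injective 1+j≡1+m) (λ _ → refl)
... | suc k | inj₂ k≡1+j = mk⇔ (λ ()) λ j≡m →
  contradiction (subst (ℕ._< suc m) (trans (ℕ.suc-injective k≡1+j) (cong suc j≡m)) (toℕ<n k)) (ℕ.n≮n (suc m))

module Unrolling (m : ℕ) where

  wrap : ℕ → Fin (suc m)
  wrap i = i mod suc m

  toℕ-wrap : ∀ i → toℕ (wrap i) ≡ i % suc m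
  toℕ-wrap i = toℕ-fromℕ< _

  wrap-toℕ : ∀ a → wrap (toℕ a) ≡ a
  wrap-toℕ a = toℕ-injective (trans (toℕ-wrap (toℕ a)) (m<n⇒m%n≡m (toℕ<n a)))

  wrap-suc : ∀ i → wrap (suc i) ≡ next (wrap i)
  wrap-suc i = toℕ-injective (begin
    toℕ (wrap (suc i))                       ≡⟨ toℕ-wrap (suc i) ⟩
    (1 + i) % suc m                          ≡⟨ %-distribˡ-+ 1 i (suc m) ⟩
    (1 % suc m + i % suc m) % suc m          ≡⟨ cong (λ k → (1 % suc m + k) % suc m) (m%n%n≡m%n i (suc m)) ⟨
    (1 % suc m + i % suc m % suc m) % suc m  ≡⟨ %-distribˡ-+ 1 (i % suc m) (suc m) ⟨
    suc (i % suc m) % suc m                  ≡⟨ cong (λ k → suc k % suc m) (toℕ-wrap i) ⟨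
    suc (toℕ (wrap i)) % suc m               ≡⟨ toℕ-next (wrap i) ⟨
    toℕ (next (wrap i))                      ∎)
    where open ≡-Reasoning

  wrap-periodic : ∀ i → wrap (i + suc m) ≡ wrap i
  wrap-periodic i = toℕ-injective (trans (toℕ-wrap (i + suc m)) (trans ([m+n]%n≡m%n i (suc m)) (sym (toℕ-wrap i))))

  wrap-injective-window : ∀ {x y} → wrap x ≡ wrap y → x ℕ.< y + suc m → y ℕ.< x + suc m → x ≡ y
  wrap-injective-window {x} {y} eq = %-injective-window (suc m)
    (trans (sym (toℕ-wrap x)) (trans (cong toℕ eq) (toℕ-wrap y)))

  wrap-injective-offset : ∀ {p i j} → i ℕ.< suc m → j ℕ.< suc m → wrap (p + i) ≡ wrap (p + j) → i ≡ j
  wrap-injective-offset {p} {i} {j} i<r j<r eq =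
    ℕ.+-cancelˡ-≡ p i j (wrap-injective-window eq (offset-< j i<r) (offset-< i j<r))
    where
    offset-< : ∀ k {l} → l ℕ.< suc m → p + l ℕ.< p + k + suc m
    offset-< k l<r = ℕ.<-≤-trans (ℕ.+-monoʳ-< p l<r) (ℕ.+-monoˡ-≤ (suc m) (ℕ.m≤m+n p k))

  wrap≡next⇔ : ∀ {p i j} → suc i ℕ.< suc m → j ℕ.< suc m → wrap (p + j) ≡ next (wrap (p + i)) ⇔ j ≡ suc i
  wrap≡next⇔ {p} {i} {j} 1+i<r j<r = mk⇔
    (λ eq → wrap-injective-offset {p} j<r 1+i<r (trans eq (sym next-position)))
    (λ { refl → next-position })
    where
    next-position : wrap (p + suc i) ≡ next (wrap (p + i))
    next-position = trans (cong wrap (ℕ.+-suc p i)) (wrap-suc (p + i))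

  between : ∀ {a b : Fin (suc m)} → a ≢ b → Σ ℕ λ I → wrap I ≡ b × toℕ a ℕ.< I × I ℕ.< toℕ a + suc m
  between {a} {b} a≢b with toℕ a ℕ.<? toℕ b
  ... | yes a<b = toℕ b , wrap-toℕ b , a<b , ℕ.<-≤-trans (toℕ<n b) (ℕ.m≤n+m (suc m) (toℕ a))
  ... | no a≮b = toℕ b + suc m , trans (wrap-periodic (toℕ b)) (wrap-toℕ b) ,
                 ℕ.<-≤-trans (toℕ<n a) (ℕ.m≤n+m (suc m) (toℕ b)) , ℕ.+-monoˡ-< (suc m) b<a
    where
    b<a : toℕ b ℕ.< toℕ a
    b<a = ℕ.≤∧≢⇒< (ℕ.≮⇒≥ a≮b) (λ eq → a≢b (toℕ-injective (sym eq)))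

  separated : ∀ {B I} → B ℕ.< I → I ℕ.< B + suc m →
              wrap I ≢ next (wrap B) → wrap B ≢ next (wrap I) →
              2 + B ≤ I × 2 + I ≤ B + suc m
  separated {B} {I} B<I I<B+r I≢next-B B≢next-I =
    ℕ.≤∧≢⇒< B<I (λ 1+B≡I → I≢next-B (trans (cong wrap (sym 1+B≡I)) (wrap-suc B))) ,
    ℕ.≤∧≢⇒< I<B+r (λ 1+I≡B+r → B≢next-I
      (trans (sym (wrap-periodic B)) (trans (cong wrap (sym 1+I≡B+r)) (wrap-suc I))))

IsInducedPath : ∀ {n} → Diagram n → (m : ℕ) → (Fin m → Fin n) → Set
IsInducedPath G m π =
  Injective _≡_ _≡_ π ×
  (∀ a b → a ≢ b → Adj G (π a) (π b) ⇔ (toℕ b ≡ suc (toℕ a) ⊎ toℕ a ≡ suc (toℕ b)))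

cone : ∀ {n m} → Fin n → (Fin m → Fin n) → Fin (suc m) → Fin n
cone k π zero = k
cone k π (suc a) = π a

cone-isCycle : ∀ {n s} {G : Diagram n} {k} {π : Fin (2 + s) → Fin n} →
  Symmetric (Adj G) → IsInducedPath G (2 + s) π → (∀ a → π a ≢ k) →
  (∀ a → Adj G k (π a) ⇔ (toℕ a ≡ 0 ⊎ toℕ a ≡ suc s)) → IsCycle G s (cone k π)
cone-isCycle {G = G} {k = k} {π = π} adj-sym (π-injective , π-adj) π≢k k-adj = injective , adjacent
  where
  injective : Injective _≡_ _≡_ (cone k π)
  injective {zero}  {zero}  _  = refl
  injective {zero}  {suc b} eq = contradiction (sym eq) (π≢k b)
  injective {suc a} {zero}  eq = contradiction eq (π≢k a)
  injective {suc a} {suc b} eq = cong suc (π-injective eq)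

  apex : ∀ j → Adj G k (π j) ⇔ (suc j ≡ next zero ⊎ zero ≡ next (suc j))
  apex j = ⇔.trans (k-adj j) (⇔.sym (suc≡suc-zero⇔ ⊎-⇔ zero≡next-suc⇔ j))
    where
    suc≡suc-zero⇔ : suc j ≡ suc zero ⇔ toℕ j ≡ 0
    suc≡suc-zero⇔ = mk⇔ (λ { refl → refl }) (λ j≡0 → cong suc (toℕ-injective j≡0))

  adjacent : ∀ a b → a ≢ b → Adj G (cone k π a) (cone k π b) ⇔ (b ≡ next a ⊎ a ≡ next b)
  adjacent zero    zero    a≢b = contradiction refl a≢b
  adjacent zero    (suc j) _   = apex j
  adjacent (suc i) zero    _   = ⇔.trans (mk⇔ adj-sym adj-sym) (⇔.trans (apex i) (↔⇒⇔ (⊎-comm _ _)))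
  adjacent (suc i) (suc j) a≢b = ⇔.trans (π-adj i j (a≢b ∘ cong suc))
    (⇔.sym (suc≡next-suc⇔ i j ⊎-⇔ suc≡next-suc⇔ j i))

module Companion {n} {G : Diagram n} {A : Mat n} (companion : QuasiCartanCompanion G A) where

  private
    d : Fin n → ℤ
    d = proj₁ (proj₂ (proj₁ companion))
    d-positive : ∀ i → 0ℤ < d i
    d-positive = proj₁ (proj₂ (proj₂ (proj₁ companion)))
    dA-symmetric : ∀ i j → d i ℤ.* A i j ≡ d j ℤ.* A j i
    dA-symmetric = proj₂ (proj₂ (proj₂ (proj₁ companion)))
    B : Mat n
    B = proj₁ (proj₂ companion)
    ΓB≡G : ∀ i j → Γ B i j ≡ G i j
    ΓB≡G = proj₁ (proj₂ (proj₂ (proj₂ companion)))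
    ∣A∣≡∣B∣ : ∀ i j → i ≢ j → ∣ A i j ∣ ≡ ∣ B i j ∣
    ∣A∣≡∣B∣ = proj₂ (proj₂ (proj₂ (proj₂ companion)))

    adj⇒B≢0 : ∀ {i j} → Adj G i j → B i j ≢ 0ℤ × B j i ≢ 0ℤ
    adj⇒B≢0 {i} {j} adj =
      (λ Bij≡0 → adj (trans (sym (ΓB≡G i j)) (cong (ℤ._* + ∣ B j i ∣) Bij≡0))) ,
      (λ Bji≡0 → adj (trans (sym (ΓB≡G i j)) (trans (cong (λ b → B i j ℤ.* + ∣ b ∣) Bji≡0) (ℤ.*-zeroʳ (B i j)))))

  adj-sym : Symmetric (Adj G)
  adj-sym {i} {j} adj Gji≡0 with ℤ.i*j≡0⇒i≡0∨j≡0 (B j i) (trans (ΓB≡G j i) Gji≡0)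
  ... | inj₁ Bji≡0   = proj₂ (adj⇒B≢0 adj) Bji≡0
  ... | inj₂ ∣Bij∣≡0 = proj₁ (adj⇒B≢0 adj) (ℤ.∣i∣≡0⇒i≡0 (ℤ.+-injective ∣Bij∣≡0))

  -A≢0 : ∀ {i j} → i ≢ j → Adj G i j → - A i j ≢ 0ℤ
  -A≢0 {i} {j} i≢j adj -Aij≡0 = proj₁ (adj⇒B≢0 adj)
    (ℤ.∣i∣≡0⇒i≡0 (trans (sym (∣A∣≡∣B∣ i j i≢j)) (trans (sym (ℤ.∣-i∣≡∣i∣ (A i j))) (cong ∣_∣ -Aij≡0))))

  sign-A-sym : ∀ i j → sign (- A i j) ≡ sign (- A j i)
  sign-A-sym i j = begin
    sign (- A i j)            ≡⟨ sign-pos-* (- A i j) (d-positive i) ⟨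
    sign (d i ℤ.* - A i j)    ≡⟨ cong sign (ℤ.neg-distribʳ-* (d i) (A i j)) ⟨
    sign (- (d i ℤ.* A i j))  ≡⟨ cong (sign ∘ -_) (dA-symmetric i j) ⟩
    sign (- (d j ℤ.* A j i))  ≡⟨ cong sign (ℤ.neg-distribʳ-* (d j) (A j i)) ⟩
    sign (d j ℤ.* - A j i)    ≡⟨ sign-pos-* (- A j i) (d-positive j) ⟩
    sign (- A j i)            ∎
    where open ≡-Reasoning

module Cycle {n} (G : Diagram n) (A : Mat n) (k : Fin n) (s : ℕ) (v : Fin (3 + s) → Fin n)
  (cycle : IsCycle G s v) (k∉v : ∀ a → v a ≢ k) (companion : QuasiCartanCompanion G A) where

  open Unrolling (2 + s) public
  open Companion companion

  r : ℕ
  r = 3 + s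

  v≢v-next : ∀ a → v a ≢ v (next a)
  v≢v-next a eq = next≢id a (sym (proj₁ cycle eq))

  -A-edge≢0 : ∀ a → - A (v a) (v (next a)) ≢ 0ℤ
  -A-edge≢0 a = -A≢0 (v≢v-next a) (Equivalence.from (proj₂ cycle a (next a) (next≢id a ∘ sym)) (inj₁ refl))

  u : ℕ → Fin n
  u i = v (wrap i)

  -A-u≢0 : ∀ i → - A (u i) (u (suc i)) ≢ 0ℤ
  -A-u≢0 i = subst (λ b → - A (u i) (v b) ≢ 0ℤ) (sym (wrap-suc i)) (-A-edge≢0 (wrap i))

  N : ℕ → Set
  N i = Adj G k (u i)

  t e : ℕ → Sign
  t i = sign (- A (u i) (u (suc i)))
  e i = sign (- A k (u i))

  open ArcDecomposition t e {N = N} (λ i → Adj? G k (u i)) public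

  segment : ∀ p m → Fin m → Fin n
  segment p m a = u (p + toℕ a)

  segment-induced : ∀ p d → suc d ℕ.< r → IsInducedPath G (suc d) (segment p (suc d))
  segment-induced p d 1+d<r = injective , adjacent
    where
    1+a<r : ∀ (a : Fin (suc d)) → suc (toℕ a) ℕ.< r
    1+a<r a = ℕ.≤-<-trans (toℕ<n a) 1+d<r
    a<r : ∀ (a : Fin (suc d)) → toℕ a ℕ.< r
    a<r a = ℕ.<-trans (toℕ<n a) 1+d<r
    wrap-injective : ∀ {a b} → wrap (p + toℕ a) ≡ wrap (p + toℕ b) → a ≡ b
    wrap-injective {a} {b} eq = toℕ-injective (wrap-injective-offset {p} (a<r a) (a<r b) eq)
    injective : Injective _≡_ _≡_ (segment p (suc d))
    injective eq = wrap-injective (proj₁ cycle eq)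
    adjacent : ∀ a b → a ≢ b → Adj G (segment p (suc d) a) (segment p (suc d) b) ⇔
               (toℕ b ≡ suc (toℕ a) ⊎ toℕ a ≡ suc (toℕ b))
    adjacent a b a≢b = ⇔.trans (proj₂ cycle _ _ (a≢b ∘ wrap-injective))
      (wrap≡next⇔ {p} (1+a<r a) (a<r b) ⊎-⇔ wrap≡next⇔ {p} (1+a<r b) (a<r a))

  CycleThroughK : Set
  CycleThroughK = Σ ℕ λ s′ → Σ (Fin (3 + s′) → Fin n) λ v′ →
    IsCycle G s′ v′ × (∃ λ a → v′ a ≡ k) × 0ℤ < cycleProd A s′ v′

  module Arc {p d} (consecutive : Consecutive p (suc d)) where

    π : Fin (2 + d) → Fin n
    π = segment p (2 + d)

    w : ℕ → Fin n
    w zero = k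
    w (suc i) = u (p + i)

    cone≡w : ∀ a → cone k π a ≡ w (toℕ a)
    cone≡w zero = refl
    cone≡w (suc a) = refl

    edge : ℕ → ℤ
    edge i = - A (w i) (w (suc i % (3 + d)))

    cycleProd≡ : cycleProd A d (cone k π) ≡ prodFin (3 + d) (edge ∘ toℕ)
    cycleProd≡ = prodFin-cong (3 + d) λ a →
      cong₂ (λ x y → - A x y) (cone≡w a) (trans (cone≡w (next a)) (cong w (toℕ-next a)))

    edge-first : edge 0 ≡ - A k (u p)
    edge-first = cong (λ i → - A k (u i)) (ℕ.+-identityʳ p)

    edge-middle : ∀ {i} → i ℕ.< suc d → edge (suc i) ≡ - A (u (p + i)) (u (suc (p + i)))
    edge-middle {i} i<1+d = trans (cong (λ j → - A (u (p + i)) (w j)) (m<n⇒m%n≡m (s≤s (s≤s i<1+d))))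
                                  (cong (λ j → - A (u (p + i)) (u j)) (ℕ.+-suc p i))

    edge-last : edge (2 + d) ≡ - A (u (p + suc d)) k
    edge-last = cong (λ j → - A (u (p + suc d)) (w j)) (n%n≡0 (3 + d))

    edge≢0 : ∀ i → i ℕ.< 3 + d → edge i ≢ 0ℤ
    edge≢0 zero _ = subst (_≢ 0ℤ) (sym edge-first) (-A≢0 (k∉v (wrap p) ∘ sym) (proj₁ consecutive))
    edge≢0 (suc i) (s≤s i<2+d) with i ℕ.≟ suc d
    ... | yes refl = subst (_≢ 0ℤ) (sym edge-last) (-A≢0 (k∉v _) (adj-sym (proj₁ (proj₂ consecutive))))
    ... | no i≢1+d = subst (_≢ 0ℤ) (sym (edge-middle (ℕ.≤∧≢⇒< (ℕ.≤-pred i<2+d) i≢1+d))) (-A-u≢0 (p + i))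

    sign-edges : prodFin (3 + d) (edge ∘ toℕ) ≢ 0ℤ ×
                 sign (prodFin (3 + d) (edge ∘ toℕ)) ≡ ∏ˢ {3 + d} (sign ∘ edge ∘ toℕ)
    sign-edges = sign-prodFin (3 + d) (edge ∘ toℕ) (λ a → edge≢0 (toℕ a) (toℕ<n a))

    sign-cycleProd : sign (cycleProd A d (cone k π)) ≡ arcSign p (suc d)
    sign-cycleProd = begin
      sign (cycleProd A d (cone k π))       ≡⟨ cong sign cycleProd≡ ⟩
      sign (prodFin (3 + d) (edge ∘ toℕ))   ≡⟨ proj₂ sign-edges ⟩
      ∏ˢ {3 + d} (σ ∘ toℕ)                  ≡⟨ ∏ˢ-∏ᵂ σ 0 (3 + d) ⟩
      ∏ᵂ σ 0 (2 + d) * σ (2 + d)            ≡⟨ cong (_* σ (2 + d)) (∏ᵂ-cons σ 0 (suc d)) ⟩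
      σ 0 * ∏ᵂ σ 1 (suc d) * σ (2 + d)      ≡⟨ cong₂ _*_ (cong₂ _*_ (cong sign edge-first)
                                                 (∏ᵂ-shift (suc d) (λ i i<1+d → cong sign (edge-middle i<1+d))))
                                                 (trans (cong sign edge-last) (sign-A-sym _ k)) ⟩
      e p * ∏ᵂ t p (suc d) * e (p + suc d)  ∎
      where
      open ≡-Reasoning
      σ : ℕ → Sign
      σ = sign ∘ edge

    positive⇒cycle : 2 + suc d ≤ r → arcSign p (suc d) ≡ Sign.+ → CycleThroughK
    positive⇒cycle short positive = d , cone k π ,
      cone-isCycle adj-sym (segment-induced p (suc d) short) (λ a → k∉v (wrap (p + toℕ a)))
                   (λ a → marks-in-arc {p} {suc d} consecutive (toℕ a) (ℕ.≤-pred (toℕ<n a))) ,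
      (zero , refl) ,
      sign≡+⇒0< (subst (_≢ 0ℤ) (sym cycleProd≡) (proj₁ sign-edges)) (trans sign-cycleProd positive)

  marked-at : ∀ {a} i → wrap i ≡ a → Adj G k (v a) → N i
  marked-at i wrap-i≡a = subst (Adj G k ∘ v) (sym wrap-i≡a)

  -- A mark at cyclic distance at least 2 from B on both sides: no arc between consecutive marks
  -- passes over it, so every arc inside the window B, …, B + r misses two vertices of C.
  record SeparatingMark (B : ℕ) : Set where
    field
      I      : ℕ
      marked : N I
      after  : 2 + B ≤ I
      before : 2 + I ≤ B + r

  separating-mark : ∀ {a b} → Adj G k (v b) → ¬ Adj G (v a) (v b) → a ≢ b → SeparatingMark (toℕ a)
  separating-mark {a} {b} k~b a≁b a≢b with between a≢b
  ... | I , wrap-I≡b , a<I , I<a+r = record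
    { I = I ; marked = marked-at I wrap-I≡b k~b ; after = proj₁ separation ; before = proj₂ separation }
    where
    adjacent : b ≡ next a ⊎ a ≡ next b → Adj G (v a) (v b)
    adjacent = Equivalence.from (proj₂ cycle a b a≢b)
    separation : 2 + toℕ a ≤ I × 2 + I ≤ toℕ a + r
    separation = separated a<I I<a+r
      (λ eq → a≁b (adjacent (inj₁ (trans (sym wrap-I≡b) (trans eq (cong next (wrap-toℕ a)))))))
      (λ eq → a≁b (adjacent (inj₂ (trans (sym (wrap-toℕ a)) (trans eq (cong next wrap-I≡b))))))

  separated⇒short-arc : ∀ {B p d} → SeparatingMark B → B ≤ p → p + d ≤ B + r → Consecutive p d → 2 + d ≤ r
  separated⇒short-arc mark B≤p arc≤ (_ , _ , unmarked) =
    short-arc B≤p arc≤ after before (marks-outside unmarked marked)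
    where open SeparatingMark mark

  ∏ᵂt≡- : cycleProd A s v < 0ℤ → ∀ B → ∏ᵂ t B r ≡ Sign.-
  ∏ᵂt≡- negative B = begin
    ∏ᵂ t B r                                      ≡⟨ ∏ᵂ-periodic t-periodic B ⟩
    ∏ᵂ t 0 r                                      ≡⟨ ∏ˢ-∏ᵂ t 0 r ⟨
    ∏ˢ {r} (t ∘ toℕ)                              ≡⟨ ∏ˢ-cong {r} t-toℕ ⟩
    ∏ˢ {r} (λ a → sign (- A (v a) (v (next a))))  ≡⟨ proj₂ (sign-prodFin r _ -A-edge≢0) ⟨
    sign (cycleProd A s v)                        ≡⟨ <0⇒sign≡- negative ⟩
    Sign.-                                        ∎
    where
    open ≡-Reasoning
    t-periodic : ∀ i → t (i + r) ≡ t i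
    t-periodic i = cong₂ (λ a b → sign (- A (v a) (v b))) (wrap-periodic i) (wrap-periodic (suc i))
    t-toℕ : ∀ a → t (toℕ a) ≡ sign (- A (v a) (v (next a)))
    t-toℕ a = cong₂ (λ a b → sign (- A (v a) (v b))) (wrap-toℕ a) (trans (wrap-suc (toℕ a)) (cong next (wrap-toℕ a)))

  ∏ᵂχ≡+ : 2 ∣ adjCount G k v → ∀ B → ∏ᵂ χ B r ≡ Sign.+
  ∏ᵂχ≡+ even B = begin
    ∏ᵂ χ B r                                         ≡⟨ ∏ᵂ-periodic (λ i → χ-at (i + r) (wrap-periodic i)) B ⟩
    ∏ᵂ χ 0 r                                         ≡⟨ ∏ˢ-∏ᵂ χ 0 r ⟨
    ∏ˢ {r} (χ ∘ toℕ)                                 ≡⟨ ∏ˢ-cong {r} (λ a → χ-at (toℕ a) (wrap-toℕ a)) ⟩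
    ∏ˢ {r} (λ a → markSign (does (Adj? G k (v a))))  ≡⟨ ×ˢ-length-filter (λ a → Adj? G k (v a)) r id ⟨
    adjCount G k v ×ˢ Sign.-                         ≡⟨ even-×ˢ- even ⟩
    Sign.+                                           ∎
    where
    open ≡-Reasoning
    χ-at : ∀ i {a} → wrap i ≡ a → χ i ≡ markSign (does (Adj? G k (v a)))
    χ-at _ wrap-i≡a = cong (λ a → markSign (does (Adj? G k (v a)))) wrap-i≡a

  closing-impossible : cycleProd A s v < 0ℤ → 2 ∣ adjCount G k v →
                       ∀ B → e B * ∏ᵂ t B r ≢ ∏ᵂ χ (suc B) r * e (B + r)
  closing-impossible negative even B closes = Sign.s≢opposite[s] (e B) (begin
    e B                         ≡⟨ cong₂ _*_ (∏ᵂχ≡+ even (suc B)) e-periodic ⟨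
    ∏ᵂ χ (suc B) r * e (B + r)  ≡⟨ closes ⟨
    e B * ∏ᵂ t B r              ≡⟨ cong (e B *_) (∏ᵂt≡- negative B) ⟩
    e B * Sign.-                ≡⟨ Sign.*-comm (e B) Sign.- ⟩
    Sign.opposite (e B)         ∎)
    where
    open ≡-Reasoning
    e-periodic : e (B + r) ≡ e B
    e-periodic = cong (λ a → sign (- A k (v a))) (wrap-periodic B)

lemma4p6 : ∀ {n} (G : Diagram n) (A : Mat n) (k : Fin n)
    (s : ℕ) (v : Fin (3 + s) → Fin n) →
    IsCycle G s v →
    (∀ a → v a ≢ k) →
    (∀ j → j ≢ k → ∃ λ a → v a ≡ j) →
    QuasiCartanCompanion G A →
    cycleProd A s v < 0ℤ →
    2 ∣ adjCount G k v →
    (∃ λ a → ∃ λ b → Adj G k (v a) × Adj G k (v b) × ¬ Adj G (v a) (v b) × a ≢ b) →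
    Σ ℕ λ s′ → Σ (Fin (3 + s′) → Fin n) λ v′ →
      IsCycle G s′ v′ × (∃ λ a → v′ a ≡ k) × 0ℤ < cycleProd A s′ v′
lemma4p6 G A k s v cycle k∉v _ companion negative even (a₀ , b₀ , k~a₀ , k~b₀ , a₀≁b₀ , a₀≢b₀) =
  [ (λ { (p , d , B≤p , arc≤ , consecutive , positive) →
         Arc.positive⇒cycle {p} {d} consecutive (separated⇒short-arc separation B≤p arc≤ consecutive) positive })
  , (λ closes → contradiction closes (closing-impossible negative even B))
  ]′ (closed-walk {B} {r} (marked-at B (wrap-toℕ a₀) k~a₀)
                          (marked-at (B + r) (trans (wrap-periodic B) (wrap-toℕ a₀)) k~a₀))
  where
  open Cycle G A k s v cycle k∉v companion
  B : ℕ
  B = toℕ a₀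
  separation : SeparatingMark B
  separation = separating-mark k~b₀ a₀≁b₀ a₀≢b₀
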